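{- Let $G$ be a graph of treewidth $t \geq 1$, and let $\omega$ be an integer with $2 \leq \omega \leq t$. If the largest clique in $G$ has at most $\omega$ vertices, then $\chi_f(G) \leq t + \frac{\omega - 1}{t}$.
   Context: Graphs are finite and simple. A $t$-tree is a graph obtained by starting with a $t$-clique and then iteratively adding vertices $v$ such that, at the time $v$ is added, its neighborhood $N(v)$ induces a $K_t$. A partial $t$-tree is a subgraph of a $t$-tree. The treewidth of $G$ is the minimum $t$ for which $G$ is a partial $t$-tree (this agrees with the usual definition of treewidth). A fractional coloring of $G$ assigns to each vertex $v \in V(G)$ a set $\phi(v) \subseteq \mathbb{R}$ of Lebesgue measure $\mu(\phi(v)) = 1$ so that $\phi(u) \cap \phi(v) = \emptyset$ for each edge $uv \in E(G)$. The fractional chromatic number $\chi_f(G)$ is the infimum of $\mu\left(\bigcup_{v \in V(G)} \phi(v)\right)$ over all fractional colorings $\phi$ of $G$. Equivalently, $\chi_f(G) = \inf_{b \geq 1} \chi_b(G)/b$, where $\chi_b(G)$ is the least $k$ such that one can assign to each vertex a $b$-element subset of $\{1,\dots,k\}$ with adjacent vertices receiving disjoint subsets. -}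

module Defs where

open import Level using (0ℓ)
open import Data.Nat using (ℕ; suc; NonZero; _≤_)
open import Data.Integer using (+_)
open import Data.Rational as ℚ using (ℚ; _/_)
open import Data.Fin using (Fin; punchIn)
open import Data.Fin.Subset using (Subset; _∈_; _∩_; ∣_∣; ⊤; Empty)
open import Data.Product using (Σ; ∃; _×_)
open import Data.Vec using (tabulate)
open import Function.Definitions using (Injective)
open import Relation.Binary.Core using (Rel)
open import Relation.Binary.Definitions using (Decidable; Symmetric)
open import Relation.Binary.PropositionalEquality using (_≡_; _≢_)
open import Relation.Nullary using (¬_; does)
open import Relation.Unary using (Pred)

-- Adjacency is required to be decidable, so that a graph is finite data
-- (classically this is no restriction).
record Graph (n : ℕ) : Set₁ where
  infix 4 _~_ _~?_
  field
    _~_     : Rel (Fin n) 0ℓ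
    _~?_    : Decidable _~_
    ~-sym   : Symmetric _~_
    ~-irrefl : ∀ {v} → ¬ (v ~ v)

  neighborhood : Fin n → Subset n
  neighborhood v = tabulate (λ u → does (v ~? u))

  IsClique : Subset n → Set
  IsClique S = ∀ {u v} → u ∈ S → v ∈ S → u ≢ v → u ~ v

open Graph public using (neighborhood; IsClique)

-- punchIn v enumerates the vertices other than v.
delete : ∀ {n} → Graph (suc n) → Fin (suc n) → Graph n
delete G v = record
  { _~_      = λ x y → punchIn v x ~ punchIn v y
  ; _~?_     = λ x y → punchIn v x ~? punchIn v y
  ; ~-sym    = ~-sym
  ; ~-irrefl = ~-irrefl
  } where open Graph G

-- The last vertex added may carry any label v: G arises from delete G v by
-- adding v.  Hence the predicate does not depend on the labelling of G.
data IsTree (t : ℕ) : ∀ {n} → Graph n → Set₁ where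
  clique : {G : Graph t} → IsClique G ⊤ → IsTree t G
  add    : ∀ {n} {G : Graph (suc n)} (v : Fin (suc n)) →
           IsTree t (delete G v) →
           ∣ neighborhood G v ∣ ≡ t →
           IsClique G (neighborhood G v) →
           IsTree t G

-- Not necessarily induced or spanning, and up to isomorphism.
IsSubgraph : ∀ {m n} → Graph m → Graph n → Set
IsSubgraph {m} {n} G H =
  Σ (Fin m → Fin n) λ f →
    Injective _≡_ _≡_ f × (∀ {u v} → Graph._~_ G u v → Graph._~_ H (f u) (f v))

IsPartialTree : ∀ {n} → ℕ → Graph n → Set₁
IsPartialTree t G = ∃ λ m → Σ (Graph m) λ H → IsTree t H × IsSubgraph G H

HasTreewidth : ∀ {n} → Graph n → ℕ → Set₁
HasTreewidth G t = IsPartialTree t G × (∀ s → IsPartialTree s G → t ≤ s)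

CliqueNumber≤ : ∀ {n} → Graph n → ℕ → Set
CliqueNumber≤ {n} G ω = (S : Subset n) → IsClique G S → ∣ S ∣ ≤ ω

-- Assignments of b-element subsets of a k-element set, disjoint along edges.
Coloring : ∀ {n} → Graph n → (b k : ℕ) → Set
Coloring {n} G b k =
  Σ (Fin n → Subset k) λ φ →
    (∀ v → ∣ φ v ∣ ≡ b) × (∀ {u v} → Graph._~_ G u v → Empty (φ u ∩ φ v))

-- χ_b(G) = k
HasMultichromaticNumber : ∀ {n} → Graph n → (b k : ℕ) → Set
HasMultichromaticNumber G b k =
  Coloring G b k × (∀ k′ → Coloring G b k′ → k ≤ k′)

-- The set { χ_b(G) / b : b ≥ 1 }.
data ChromaticRatio {n} (G : Graph n) : Pred ℚ 0ℓ where
  ratio : ∀ b .{{_ : NonZero b}} k →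
          HasMultichromaticNumber G b k → ChromaticRatio G (+ k / b)

-- inf S ≤ r, where the infimum is a real number that need not be rational or
-- attained: whenever r < q, q is not a lower bound of S, i.e. some element of
-- S lies strictly below q.
Inf≤ : Pred ℚ 0ℓ → ℚ → Set
Inf≤ S r = ∀ q → r ℚ.< q → ∃ λ s → S s × s ℚ.< q

-- χ_f(G) ≤ r, with χ_f(G) = inf { χ_b(G) / b : b ≥ 1 }.
FractionalChromaticNumber≤ : ∀ {n} → Graph n → ℚ → Set
FractionalChromaticNumber≤ G = Inf≤ (ChromaticRatio G)

{-# OPTIONS --safe #-}
module Submission where

-- Colour a t-tree H containing G with t-subsets of a set of t² + ω − 1 colours,
-- so that two H-adjacent vertices share no colour if they are adjacent in G and
-- exactly one colour otherwise, and no colour occurs three times on a clique of H.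
-- When v is added to a t-clique K, each y ∈ K has fewer than t shared colours in K,
-- hence a private one to share with v if y and v are non-adjacent in G.  The set
-- K ∪ {v} contains at least t + 1 − ω non-edges of G, and each of them saves one
-- colour, so enough unused colours remain to complete the colour set of v.

open import Data.Bool using (if_then_else_)
open import Data.Fin as Fin using (Fin; punchIn; punchOut)
open import Data.Fin.Properties as Fin using (punchIn-injective; punchIn-punchOut)
open import Data.Fin.Subset as Subset
  using (Subset; inside; outside; ∣_∣; _∩_; _∪_; ∁; ⋃; ⁅_⁆; ⊤; Empty; _∈_)
  renaming (_⊆_ to _⊆ˢ_)
open import Data.Fin.Subset.Properties
open import Data.List using (List; []; _∷_; length; map; filter; allFin)
open import Data.List.Properties using (map-cong-local; filter-notAll; length-map; map-∘)
open import Data.List.Membership.Propositional using () renaming (_∈_ to _∈ˡ_)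
open import Data.List.Membership.Propositional.Properties
  using (∈-filter⁺; ∈-filter⁻; ∈-allFin; ∈-map⁻)
open import Data.List.Relation.Unary.All as All using (All; []; _∷_)
open import Data.List.Relation.Unary.AllPairs as AllPairs using (AllPairs; []; _∷_)
import Data.List.Relation.Unary.AllPairs.Properties as AllPairs
open import Data.List.Relation.Unary.Any as Any using (here; there)
open import Data.List.Relation.Unary.Unique.Propositional using (Unique)
import Data.List.Relation.Unary.Unique.Propositional.Properties as Unique
open import Data.Nat using (ℕ; zero; suc; NonZero; _≤_; _<_; _*_; _∸_; z≤n; s≤s; s≤s⁻¹) renaming (_+_ to _+ⁿ_)
open import Data.Nat.ListAction using (sum)
open import Data.Nat.Properties
open import Data.Integer as ℤ using (+_; 1ℤ; _-_)
import Data.Integer.Properties as ℤ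
open import Data.Nat.Induction using (<-rec)
open import Data.Product using (∃; _×_; _,_; proj₁; proj₂)
open import Data.Rational as ℚ using (_/_; _+_; toℚᵘ)
import Data.Rational.Properties as ℚ
open import Data.Rational.Unnormalised as ℚᵘ using (mkℚᵘ; *≤*)
import Data.Rational.Unnormalised.Properties as ℚᵘ
open import Data.Sum using (_⊎_; inj₁; inj₂)
open import Data.Vec as Vec using (here; there; []; _∷_)
open import Data.Vec.Functional using (insertAt)
open import Data.Vec.Functional.Properties using (insertAt-lookup; insertAt-punchIn)
open import Data.Vec.Properties using (lookup⇒[]=; lookup∘tabulate)
open import Function using (_∘_; _on_)
open import Relation.Binary.PropositionalEquality
open import Relation.Nullary using (¬_; Dec; yes; no; does; ¬?; contradiction)
open import Relation.Nullary.Decidable using (dec-true; map′; _×-dec_; _→-dec_)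
open import Defs

-- Cardinalities of finite sets.

∣p∪q∣+∣p∩q∣ : ∀ {k} (p q : Subset k) → ∣ p ∪ q ∣ +ⁿ ∣ p ∩ q ∣ ≡ ∣ p ∣ +ⁿ ∣ q ∣
∣p∪q∣+∣p∩q∣ []            []            = refl
∣p∪q∣+∣p∩q∣ (outside ∷ p) (outside ∷ q) = ∣p∪q∣+∣p∩q∣ p q
∣p∪q∣+∣p∩q∣ (inside ∷ p)  (outside ∷ q) = cong suc (∣p∪q∣+∣p∩q∣ p q)
∣p∪q∣+∣p∩q∣ (outside ∷ p) (inside ∷ q)  =
  trans (cong suc (∣p∪q∣+∣p∩q∣ p q)) (sym (+-suc ∣ p ∣ ∣ q ∣))
∣p∪q∣+∣p∩q∣ (inside ∷ p)  (inside ∷ q)  = cong suc (begin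
  ∣ p ∪ q ∣ +ⁿ suc ∣ p ∩ q ∣   ≡⟨ +-suc ∣ p ∪ q ∣ ∣ p ∩ q ∣ ⟩
  suc (∣ p ∪ q ∣ +ⁿ ∣ p ∩ q ∣) ≡⟨ cong suc (∣p∪q∣+∣p∩q∣ p q) ⟩
  suc (∣ p ∣ +ⁿ ∣ q ∣)         ≡⟨ +-suc ∣ p ∣ ∣ q ∣ ⟨
  ∣ p ∣ +ⁿ suc ∣ q ∣           ∎)
  where open ≡-Reasoning

∣p∩∁q∣+∣p∩q∣ : ∀ {k} (p q : Subset k) → ∣ p ∩ ∁ q ∣ +ⁿ ∣ p ∩ q ∣ ≡ ∣ p ∣
∣p∩∁q∣+∣p∩q∣ []            []            = refl
∣p∩∁q∣+∣p∩q∣ (outside ∷ p) (_ ∷ q)       = ∣p∩∁q∣+∣p∩q∣ p q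
∣p∩∁q∣+∣p∩q∣ (inside ∷ p)  (outside ∷ q) = cong suc (∣p∩∁q∣+∣p∩q∣ p q)
∣p∩∁q∣+∣p∩q∣ (inside ∷ p)  (inside ∷ q)  =
  trans (+-suc ∣ p ∩ ∁ q ∣ ∣ p ∩ q ∣) (cong suc (∣p∩∁q∣+∣p∩q∣ p q))

Empty⇒∣p∣≡0 : ∀ {k} {p : Subset k} → Empty p → ∣ p ∣ ≡ 0
Empty⇒∣p∣≡0 {k} p≡∅ = trans (cong ∣_∣ (Empty-unique p≡∅)) (∣⊥∣≡0 k)

∣p∣≡0⇒Empty : ∀ {k} {p : Subset k} → ∣ p ∣ ≡ 0 → Empty p
∣p∣≡0⇒Empty {p = p} ∣p∣≡0 (x , x∈p) = n≮0 (subst (∣ p Subset.- x ∣ <_) ∣p∣≡0 (x∈p⇒∣p-x∣<∣p∣ x∈p))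

∣p∪q∣-disjoint : ∀ {k} {p q : Subset k} → Empty (p ∩ q) → ∣ p ∪ q ∣ ≡ ∣ p ∣ +ⁿ ∣ q ∣
∣p∪q∣-disjoint {p = p} {q} p∩q≡∅ = begin
  ∣ p ∪ q ∣                ≡⟨ +-identityʳ _ ⟨
  ∣ p ∪ q ∣ +ⁿ 0           ≡⟨ cong (∣ p ∪ q ∣ +ⁿ_) (Empty⇒∣p∣≡0 p∩q≡∅) ⟨
  ∣ p ∪ q ∣ +ⁿ ∣ p ∩ q ∣   ≡⟨ ∣p∪q∣+∣p∩q∣ p q ⟩
  ∣ p ∣ +ⁿ ∣ q ∣           ∎
  where open ≡-Reasoning

first : ∀ {k} → ℕ → Subset k → Subset k
first _       []            = []
first m       (outside ∷ p) = outside ∷ first m p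
first zero    (inside ∷ p)  = outside ∷ first zero p
first (suc m) (inside ∷ p)  = inside ∷ first m p

first⊆ : ∀ {k} m (p : Subset k) → first m p ⊆ˢ p
first⊆ m       (outside ∷ p) (there x∈) = there (first⊆ m p x∈)
first⊆ zero    (inside ∷ p)  (there x∈) = there (first⊆ zero p x∈)
first⊆ (suc m) (inside ∷ p)  here       = here
first⊆ (suc m) (inside ∷ p)  (there x∈) = there (first⊆ m p x∈)

∣first∣ : ∀ {k} m (p : Subset k) → m ≤ ∣ p ∣ → ∣ first m p ∣ ≡ m
∣first∣ zero    []            _         = refl
∣first∣ m       (outside ∷ p) m≤        = ∣first∣ m p m≤
∣first∣ zero    (inside ∷ p)  _         = ∣first∣ zero p z≤n
∣first∣ (suc m) (inside ∷ p)  (s≤s m≤)  = cong suc (∣first∣ m p m≤)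

-- Sums over lists and over pairs of entries.

sum-map-≤-length : ∀ {A : Set} (f : A → ℕ) {xs} → All (λ x → f x ≤ 1) xs → sum (map f xs) ≤ length xs
sum-map-≤-length f []         = z≤n
sum-map-≤-length f (fx≤1 ∷ h) = +-mono-≤ fx≤1 (sum-map-≤-length f h)

sum-map-const : ∀ {A : Set} (f : A → ℕ) {c} → (∀ x → f x ≡ c) → ∀ xs → sum (map f xs) ≡ c * length xs
sum-map-const f {c} f≡c []       = sym (*-zeroʳ c)
sum-map-const f {c} f≡c (x ∷ xs) =
  trans (cong₂ _+ⁿ_ (f≡c x) (sum-map-const f f≡c xs)) (sym (*-suc c (length xs)))

pairSum : ∀ {A : Set} → (A → A → ℕ) → List A → ℕ
pairSum g []       = 0
pairSum g (x ∷ xs) = sum (map (g x) xs) +ⁿ pairSum g xs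

pairSum-cong : ∀ {A : Set} {f g : A → A → ℕ} {xs} →
               AllPairs (λ x y → f x y ≡ g x y) xs → pairSum f xs ≡ pairSum g xs
pairSum-cong []      = refl
pairSum-cong (h ∷ p) = cong₂ _+ⁿ_ (cong sum (map-cong-local h)) (pairSum-cong p)

pairSum-map : ∀ {A B : Set} (g : B → B → ℕ) (f : A → B) xs →
              pairSum g (map f xs) ≡ pairSum (g on f) xs
pairSum-map g f []       = refl
pairSum-map g f (x ∷ xs) = cong₂ _+ⁿ_ (cong sum (sym (map-∘ xs))) (pairSum-map g f xs)

Unique⇒AllPairs : ∀ {A : Set} {R : A → A → Set} {xs} → Unique xs →
                  (∀ {x y} → x ∈ˡ xs → y ∈ˡ xs → x ≢ y → R x y) → AllPairs R xs
Unique⇒AllPairs []         _ = []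
Unique⇒AllPairs (x∉ ∷ uxs) r =
  All.tabulate (λ y∈ → r (here refl) (there y∈) (All.lookup x∉ y∈)) ∷
  Unique⇒AllPairs uxs (λ x∈ y∈ → r (there x∈) (there y∈))

-- Unions of families of sets.

module _ {A : Set} {k : ℕ} (f : A → Subset k) where

  ∈-⋃⁻ : ∀ xs {c} → c ∈ ⋃ (map f xs) → ∃ λ x → x ∈ˡ xs × c ∈ f x
  ∈-⋃⁻ []       c∈ = contradiction c∈ ∉⊥
  ∈-⋃⁻ (x ∷ xs) c∈ with x∈p∪q⁻ (f x) _ c∈
  ... | inj₁ c∈fx = x , here refl , c∈fx
  ... | inj₂ c∈⋃ with ∈-⋃⁻ xs c∈⋃
  ...   | y , y∈ , c∈fy = y , there y∈ , c∈fy

  ∈-⋃⁺ : ∀ {xs x c} → x ∈ˡ xs → c ∈ f x → c ∈ ⋃ (map f xs)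
  ∈-⋃⁺ (here refl) c∈ = x∈p∪q⁺ (inj₁ c∈)
  ∈-⋃⁺ (there x∈)  c∈ = x∈p∪q⁺ (inj₂ (∈-⋃⁺ x∈ c∈))

  -- The traces of the sets on `p` are pairwise disjoint, so their sizes add up. Disjointness is
  -- required only inside `p`: with `p = f x` this is a no-triple condition, with `p = ⊤` it is
  -- ordinary pairwise disjointness.
  ∣p∩⋃∣ : ∀ p {xs} → AllPairs (λ x y → ∀ {c} → c ∈ p → c ∈ f x → ¬ c ∈ f y) xs →
          ∣ p ∩ ⋃ (map f xs) ∣ ≡ sum (map (λ x → ∣ p ∩ f x ∣) xs)
  ∣p∩⋃∣ p []                = trans (cong ∣_∣ (∩-zeroʳ p)) (∣⊥∣≡0 k)
  ∣p∩⋃∣ p {x ∷ xs} (h ∷ hs) = begin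
    ∣ p ∩ (f x ∪ ⋃ (map f xs)) ∣           ≡⟨ cong ∣_∣ (∩-distribˡ-∪ p (f x) _) ⟩
    ∣ (p ∩ f x) ∪ (p ∩ ⋃ (map f xs)) ∣     ≡⟨ ∣p∪q∣-disjoint disjoint ⟩
    ∣ p ∩ f x ∣ +ⁿ ∣ p ∩ ⋃ (map f xs) ∣    ≡⟨ cong (∣ p ∩ f x ∣ +ⁿ_) (∣p∩⋃∣ p hs) ⟩
    ∣ p ∩ f x ∣ +ⁿ sum (map (λ y → ∣ p ∩ f y ∣) xs) ∎
    where
    open ≡-Reasoning
    disjoint : Empty ((p ∩ f x) ∩ (p ∩ ⋃ (map f xs)))
    disjoint (c , c∈) with x∈p∩q⁻ (p ∩ f x) _ c∈
    ... | c∈₁ , c∈₂ with x∈p∩q⁻ p _ c∈₁ | ∈-⋃⁻ xs (proj₂ (x∈p∩q⁻ p _ c∈₂))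
    ...   | c∈p , c∈fx | y , y∈ , c∈fy = All.lookup h y∈ c∈p c∈fx c∈fy

  NoTriple : List A → Set
  NoTriple xs = ∀ {x y z c} → x ∈ˡ xs → y ∈ˡ xs → z ∈ˡ xs → x ≢ y → y ≢ z → x ≢ z →
                c ∈ f x → c ∈ f y → ¬ c ∈ f z

  common : A → A → ℕ
  common x y = ∣ f x ∩ f y ∣

  -- Inclusion-exclusion stops after the pairs because all triple intersections are empty. The pair
  -- term stands on the left to avoid truncated subtraction.
  ∣⋃∣ : ∀ {xs} → Unique xs → NoTriple xs →
        ∣ ⋃ (map f xs) ∣ +ⁿ pairSum common xs ≡ sum (map (∣_∣ ∘ f) xs)
  ∣⋃∣ []                     _      = trans (+-identityʳ _) (∣⊥∣≡0 k)
  ∣⋃∣ {x ∷ xs} (x∉ ∷ uxs) triple = begin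
    ∣ f x ∪ U ∣ +ⁿ (sum (map (common x) xs) +ⁿ pairSum common xs)
      ≡⟨ cong (λ s → ∣ f x ∪ U ∣ +ⁿ (s +ⁿ pairSum common xs)) (∣p∩⋃∣ (f x) tripleₓ) ⟨
    ∣ f x ∪ U ∣ +ⁿ (∣ f x ∩ U ∣ +ⁿ pairSum common xs)
      ≡⟨ +-assoc ∣ f x ∪ U ∣ _ _ ⟨
    ∣ f x ∪ U ∣ +ⁿ ∣ f x ∩ U ∣ +ⁿ pairSum common xs
      ≡⟨ cong (_+ⁿ pairSum common xs) (∣p∪q∣+∣p∩q∣ (f x) U) ⟩
    ∣ f x ∣ +ⁿ ∣ U ∣ +ⁿ pairSum common xs
      ≡⟨ +-assoc ∣ f x ∣ _ _ ⟩
    ∣ f x ∣ +ⁿ (∣ U ∣ +ⁿ pairSum common xs)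
      ≡⟨ cong (∣ f x ∣ +ⁿ_) (∣⋃∣ uxs (λ a b c → triple (there a) (there b) (there c))) ⟩
    ∣ f x ∣ +ⁿ sum (map (∣_∣ ∘ f) xs) ∎
    where
    open ≡-Reasoning
    U = ⋃ (map f xs)
    tripleₓ : AllPairs (λ y z → ∀ {c} → c ∈ f x → c ∈ f y → ¬ c ∈ f z) xs
    tripleₓ = Unique⇒AllPairs uxs λ y∈ z∈ y≢z →
      triple (here refl) (there y∈) (there z∈) (All.lookup x∉ y∈) y≢z (All.lookup x∉ z∈)

-- Choosing a colour set for one new vertex attached to a clique `K`.

module Extension
  {k n t : ℕ} (φ : Fin n → Subset k) (K : List (Fin n)) (unique : Unique K) (ε : Fin n → ℕ)
  (∣φ∣≡t : ∀ y → ∣ φ y ∣ ≡ t) (ε≤1 : ∀ y → ε y ≤ 1) (∣K∣≤t : length K ≤ t)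
  (common≤1 : ∀ {y z} → y ∈ˡ K → z ∈ˡ K → y ≢ z → common φ y z ≤ 1)
  (noTriple : NoTriple φ K)
  -- By inclusion-exclusion `K` occupies `t * length K` colours minus the pair sum. The new vertex,
  -- which is to share `ε y` colours with each `y`, needs `t` minus the sum of `ε` further ones. The
  -- inequality says that both amounts fit into `k`.
  (room : t +ⁿ t * length K ≤ k +ⁿ (pairSum (common φ) K +ⁿ sum (map ε K)))
  where

  rest : Fin n → List (Fin n)
  rest y = filter (λ z → ¬? (y Fin.≟ z)) K

  private-part : Fin n → Subset k
  private-part y = φ y ∩ ∁ (⋃ (map φ (rest y)))

  ∈-private-part⁻ : ∀ {y z c} → z ∈ˡ K → y ≢ z → c ∈ private-part y → ¬ c ∈ φ z
  ∈-private-part⁻ {y} z∈K y≢z c∈ c∈φz =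
    x∈∁p⇒x∉p (proj₂ (x∈p∩q⁻ (φ y) _ c∈)) (∈-⋃⁺ φ (∈-filter⁺ _ z∈K y≢z) c∈φz)

  ∣private-part∣≥1 : ∀ {y} → y ∈ˡ K → 1 ≤ ∣ private-part y ∣
  ∣private-part∣≥1 {y} y∈K = +-cancelʳ-≤ ∣ φ y ∩ O ∣ 1 _ (begin
    1 +ⁿ ∣ φ y ∩ O ∣                      ≡⟨ cong suc (∣p∩⋃∣ φ (φ y) pairwise) ⟩
    1 +ⁿ sum (map (common φ y) (rest y)) ≤⟨ s≤s (sum-map-≤-length (common φ y) small) ⟩
    -- `y` itself is filtered out of `K`, so `rest y` is strictly shorter; this strictness provides
    -- the private colour.
    1 +ⁿ length (rest y)                  ≤⟨ filter-notAll _ K (Any.map (λ y≡z y≢z → y≢z y≡z) y∈K) ⟩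
    length K                              ≤⟨ ∣K∣≤t ⟩
    t                                     ≡⟨ ∣φ∣≡t y ⟨
    ∣ φ y ∣                               ≡⟨ ∣p∩∁q∣+∣p∩q∣ (φ y) O ⟨
    ∣ private-part y ∣ +ⁿ ∣ φ y ∩ O ∣     ∎)
    where
    open ≤-Reasoning
    O = ⋃ (map φ (rest y))
    rest⁻ : ∀ {z} → z ∈ˡ rest y → z ∈ˡ K × y ≢ z
    rest⁻ = ∈-filter⁻ (λ z → ¬? (y Fin.≟ z)) {xs = K}
    pairwise : AllPairs (λ x z → ∀ {c} → c ∈ φ y → c ∈ φ x → ¬ c ∈ φ z) (rest y)
    pairwise = Unique⇒AllPairs (Unique.filter⁺ _ unique) λ x∈ z∈ x≢z →
      noTriple y∈K (proj₁ (rest⁻ x∈)) (proj₁ (rest⁻ z∈))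
               (proj₂ (rest⁻ x∈)) x≢z (proj₂ (rest⁻ z∈))
    small : All (λ z → common φ y z ≤ 1) (rest y)
    small = All.tabulate λ z∈ → common≤1 y∈K (proj₁ (rest⁻ z∈)) (proj₂ (rest⁻ z∈))

  -- Since `ε y` is 0 or 1, this is empty or a single colour. Taking it from the private part keeps
  -- the choices for different `y` disjoint and prevents a third occurrence of a colour.
  shared : Fin n → Subset k
  shared y = first (ε y) (private-part y)

  ∈-shared⁻ : ∀ {y c} → c ∈ shared y → c ∈ private-part y
  ∈-shared⁻ {y} = first⊆ (ε y) (private-part y)

  shared⊆φ : ∀ {y c} → c ∈ shared y → c ∈ φ y
  shared⊆φ {y} c∈ = proj₁ (x∈p∩q⁻ (φ y) _ (∈-shared⁻ {y} c∈))

  ∣shared∣≡ε : ∀ {y} → y ∈ˡ K → ∣ shared y ∣ ≡ ε y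
  ∣shared∣≡ε {y} y∈K = ∣first∣ (ε y) (private-part y) (≤-trans (ε≤1 y) (∣private-part∣≥1 y∈K))

  -- The truncated subtraction in `fresh` is exact, because the sum of `ε` over `K` is at most
  -- `length K`, hence at most `t`.
  all-shared used fresh new : Subset k
  all-shared = ⋃ (map shared K)
  used       = ⋃ (map φ K)
  fresh      = first (t ∸ sum (map ε K)) (∁ used)
  new        = all-shared ∪ fresh

  ∣all-shared∣ : ∣ all-shared ∣ ≡ sum (map ε K)
  ∣all-shared∣ = begin
    ∣ all-shared ∣                         ≡⟨ cong ∣_∣ (∩-identityˡ all-shared) ⟨
    ∣ ⊤ ∩ all-shared ∣                     ≡⟨ ∣p∩⋃∣ shared ⊤ pairwise ⟩
    sum (map (λ y → ∣ ⊤ ∩ shared y ∣) K)   ≡⟨ cong sum (map-cong-local (All.tabulate λ {y} y∈ →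
                                                trans (cong ∣_∣ (∩-identityˡ (shared y))) (∣shared∣≡ε y∈))) ⟩
    sum (map ε K)                          ∎
    where
    open ≡-Reasoning
    pairwise : AllPairs (λ y z → ∀ {c} → c ∈ ⊤ → c ∈ shared y → ¬ c ∈ shared z) K
    pairwise = Unique⇒AllPairs unique λ {y} {z} _ z∈ y≢z _ c∈y c∈z →
      ∈-private-part⁻ z∈ y≢z (∈-shared⁻ {y} c∈y) (shared⊆φ {z} c∈z)

  enough-unused : t ∸ sum (map ε K) ≤ ∣ ∁ used ∣
  enough-unused = subst (t ∸ d ≤_) (sym (∣∁p∣≡n∸∣p∣ used)) (m≤n+o⇒m∸n≤o t d (begin
    t                     ≤⟨ m+n≤o⇒m≤o∸n t (+-cancelʳ-≤ e _ _ counted) ⟩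
    (d +ⁿ k) ∸ ∣ used ∣   ≡⟨ +-∸-assoc d (∣p∣≤n used) ⟩
    d +ⁿ (k ∸ ∣ used ∣)   ∎))
    where
    open ≤-Reasoning
    d = sum (map ε K)
    e = pairSum (common φ) K
    -- Adding `e` to both sides makes `∣⋃∣` applicable: `∣ used ∣ +ⁿ e` is the sum of all sizes,
    -- `t * length K`.
    counted : t +ⁿ ∣ used ∣ +ⁿ e ≤ d +ⁿ k +ⁿ e
    counted = begin
      t +ⁿ ∣ used ∣ +ⁿ e           ≡⟨ +-assoc t _ _ ⟩
      t +ⁿ (∣ used ∣ +ⁿ e)         ≡⟨ cong (t +ⁿ_) (∣⋃∣ φ unique noTriple) ⟩
      t +ⁿ sum (map (∣_∣ ∘ φ) K)   ≡⟨ cong (t +ⁿ_) (sum-map-const (∣_∣ ∘ φ) ∣φ∣≡t K) ⟩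
      t +ⁿ t * length K            ≤⟨ room ⟩
      k +ⁿ (e +ⁿ d)                ≡⟨ cong (k +ⁿ_) (+-comm e d) ⟩
      k +ⁿ (d +ⁿ e)                ≡⟨ +-assoc k d e ⟨
      k +ⁿ d +ⁿ e                  ≡⟨ cong (_+ⁿ e) (+-comm k d) ⟩
      d +ⁿ k +ⁿ e                  ∎

  fresh-unused : ∀ {y c} → y ∈ˡ K → c ∈ fresh → ¬ c ∈ φ y
  fresh-unused y∈ c∈ c∈φy = x∈∁p⇒x∉p (first⊆ (t ∸ sum (map ε K)) (∁ used) c∈) (∈-⋃⁺ φ y∈ c∈φy)

  ∣new∣ : ∣ new ∣ ≡ t
  ∣new∣ = begin
    ∣ all-shared ∪ fresh ∣            ≡⟨ ∣p∪q∣-disjoint disjoint ⟩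
    ∣ all-shared ∣ +ⁿ ∣ fresh ∣       ≡⟨ cong₂ _+ⁿ_ ∣all-shared∣ (∣first∣ _ (∁ used) enough-unused) ⟩
    d +ⁿ (t ∸ d)                      ≡⟨ m+[n∸m]≡n (≤-trans (sum-map-≤-length ε (All.universal ε≤1 K)) ∣K∣≤t) ⟩
    t                                 ∎
    where
    open ≡-Reasoning
    d = sum (map ε K)
    disjoint : Empty (all-shared ∩ fresh)
    disjoint (c , c∈) with x∈p∩q⁻ all-shared fresh c∈
    ... | c∈s , c∈f with ∈-⋃⁻ shared K c∈s
    ...   | y , y∈ , c∈y = fresh-unused y∈ c∈f (shared⊆φ {y} c∈y)

  -- A fresh colour avoids every `φ y`, and a colour chosen for some other `z` is private to `z`.
  -- Hence `new` meets `φ y` only in the colours chosen for `y` itself.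
  new∩φ⇒shared : ∀ {y c} → y ∈ˡ K → c ∈ new → c ∈ φ y → c ∈ shared y
  new∩φ⇒shared {y} y∈ c∈new c∈φy with x∈p∪q⁻ all-shared fresh c∈new
  ... | inj₂ c∈f = contradiction c∈φy (fresh-unused y∈ c∈f)
  ... | inj₁ c∈s with ∈-⋃⁻ shared K c∈s
  ...   | z , z∈ , c∈z with z Fin.≟ y
  ...     | yes refl = c∈z
  ...     | no z≢y   = contradiction c∈φy (∈-private-part⁻ y∈ z≢y (∈-shared⁻ {z} c∈z))

  ∣new∩φ∣ : ∀ {y} → y ∈ˡ K → ∣ new ∩ φ y ∣ ≡ ε y
  ∣new∩φ∣ {y} y∈ = trans (cong ∣_∣ (⊆-antisym ⊆₁ ⊆₂)) (∣shared∣≡ε y∈)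
    where
    ⊆₁ : new ∩ φ y ⊆ˢ shared y
    ⊆₁ c∈ with x∈p∩q⁻ new (φ y) c∈
    ... | c∈new , c∈φy = new∩φ⇒shared y∈ c∈new c∈φy
    ⊆₂ : shared y ⊆ˢ new ∩ φ y
    ⊆₂ c∈ = x∈p∩q⁺ (x∈p∪q⁺ (inj₁ (∈-⋃⁺ shared y∈ c∈)) , shared⊆φ {y} c∈)

  new-noTriple : ∀ {y z c} → y ∈ˡ K → z ∈ˡ K → y ≢ z → c ∈ new → c ∈ φ y → ¬ c ∈ φ z
  new-noTriple {y} y∈ z∈ y≢z c∈new c∈φy =
    ∈-private-part⁻ z∈ y≢z (∈-shared⁻ {y} (new∩φ⇒shared y∈ c∈new c∈φy))

-- Cliques and non-edges.

-- Cliques are lists here, which pass easily through vertex deletion and embeddings. Irreflexivity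
-- of adjacency already excludes repeated entries.
CliqueLength≤ : ∀ {n} → Graph n → ℕ → Set
CliqueLength≤ G ω = ∀ xs → AllPairs (Graph._~_ G) xs → length xs ≤ ω

CliqueLength≤-delete : ∀ {n} {G : Graph (suc n)} {ω} v → CliqueLength≤ G ω → CliqueLength≤ (delete G v) ω
CliqueLength≤-delete v G≤ω xs xs-clique =
  subst (_≤ _) (length-map (punchIn v) xs) (G≤ω _ (AllPairs.map⁺ xs-clique))

module _ {n : ℕ} (G : Graph n) where
  open Graph G using (_~_; _~?_; ~-sym; ~-irrefl)

  -- A vertex counts as non-adjacent to itself, so `large-clique` holds even for lists with
  -- repetitions.
  nonEdge : Fin n → Fin n → ℕ
  nonEdge x y = if does (x ~? y) then 0 else 1

  nonEdge-edge : ∀ {x y} → x ~ y → nonEdge x y ≡ 0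
  nonEdge-edge {x} {y} x~y with x ~? y
  ... | yes _  = refl
  ... | no x≁y = contradiction x~y x≁y

  nonEdge≡0⇒edge : ∀ x y → nonEdge x y ≡ 0 → x ~ y
  nonEdge≡0⇒edge x y _ with x ~? y
  nonEdge≡0⇒edge x y _  | yes x~y = x~y
  nonEdge≡0⇒edge x y () | no _

  nonEdge≤1 : ∀ x y → nonEdge x y ≤ 1
  nonEdge≤1 x y with x ~? y
  ... | yes _ = z≤n
  ... | no _  = ≤-refl

  nonEdge-sym : ∀ x y → nonEdge x y ≡ nonEdge y x
  nonEdge-sym x y with x ~? y | y ~? x
  ... | yes _   | yes _   = refl
  ... | yes x~y | no y≁x  = contradiction (~-sym x~y) y≁x
  ... | no x≁y  | yes y~x = contradiction (~-sym y~x) x≁y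
  ... | no _    | no _    = refl

  sum-nonEdge≡0⇒adjacent : ∀ x ys → sum (map (nonEdge x) ys) ≡ 0 → All (x ~_) ys
  sum-nonEdge≡0⇒adjacent x []       _  = []
  sum-nonEdge≡0⇒adjacent x (y ∷ ys) eq =
    nonEdge≡0⇒edge x y (m+n≡0⇒m≡0 _ eq) ∷
    sum-nonEdge≡0⇒adjacent x ys (m+n≡0⇒n≡0 (nonEdge x y) eq)

  -- Deleting one end of every non-edge leaves a clique.
  large-clique : ∀ xs → ∃ λ ys → AllPairs _~_ ys × (∀ {y} → y ∈ˡ ys → y ∈ˡ xs) ×
                 length xs ≤ length ys +ⁿ pairSum nonEdge xs
  large-clique []       = [] , [] , (λ ()) , z≤n
  large-clique (x ∷ xs) with large-clique xs | sum (map (nonEdge x) xs) in eq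
  ... | ys , ys-clique , ys⊆xs , bound | zero =
    x ∷ ys , All.tabulate (All.lookup (sum-nonEdge≡0⇒adjacent x xs eq) ∘ ys⊆xs) ∷ ys-clique ,
    (λ { (here refl) → here refl ; (there y∈) → there (ys⊆xs y∈) }) , s≤s bound
  ... | ys , ys-clique , ys⊆xs , bound | suc m =
    ys , ys-clique , there ∘ ys⊆xs , (begin
      suc (length xs)                          ≤⟨ s≤s bound ⟩
      suc (length ys +ⁿ e)                     ≤⟨ s≤s (+-monoʳ-≤ (length ys) (m≤n+m e m)) ⟩
      suc (length ys +ⁿ (m +ⁿ e))              ≡⟨ +-suc (length ys) (m +ⁿ e) ⟨
      length ys +ⁿ (suc m +ⁿ e)                ∎)
    where
    open ≤-Reasoning
    e = pairSum nonEdge xs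

  length≤ω+nonEdges : ∀ {ω} → CliqueLength≤ G ω → ∀ xs → length xs ≤ ω +ⁿ pairSum nonEdge xs
  length≤ω+nonEdges G≤ω xs with large-clique xs
  ... | ys , ys-clique , _ , bound = ≤-trans bound (+-monoˡ-≤ (pairSum nonEdge xs) (G≤ω ys ys-clique))

  ∈-neighborhood⁺ : ∀ {v u} → v ~ u → u ∈ neighborhood G v
  ∈-neighborhood⁺ {v} {u} v~u =
    lookup⇒[]= u _ (trans (lookup∘tabulate (λ w → does (v ~? w)) u) (dec-true (v ~? u) v~u))

-- Passing from subsets to lists in the clique bound.

fromList : ∀ {n} → List (Fin n) → Subset n
fromList xs = ⋃ (map ⁅_⁆ xs)

∈-fromList⁻ : ∀ {n} (xs : List (Fin n)) {x} → x ∈ fromList xs → x ∈ˡ xs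
∈-fromList⁻ xs x∈ with ∈-⋃⁻ ⁅_⁆ xs x∈
... | y , y∈ , x∈⁅y⁆ = subst (_∈ˡ xs) (sym (x∈⁅y⁆⇒x≡y y x∈⁅y⁆)) y∈

∣fromList∣ : ∀ {n} {xs : List (Fin n)} → Unique xs → ∣ fromList xs ∣ ≡ length xs
∣fromList∣ {n} []                     = ∣⊥∣≡0 n
∣fromList∣ {xs = x ∷ xs} (x∉ ∷ uxs) = begin
  ∣ ⁅ x ⁆ ∪ fromList xs ∣          ≡⟨ ∣p∪q∣-disjoint disjoint ⟩
  ∣ ⁅ x ⁆ ∣ +ⁿ ∣ fromList xs ∣     ≡⟨ cong₂ _+ⁿ_ (∣⁅x⁆∣≡1 x) (∣fromList∣ uxs) ⟩
  suc (length xs)                  ∎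
  where
  open ≡-Reasoning
  disjoint : Empty (⁅ x ⁆ ∩ fromList xs)
  disjoint (y , y∈) with x∈p∩q⁻ ⁅ x ⁆ _ y∈
  ... | y∈⁅x⁆ , y∈xs = All.lookup x∉ (∈-fromList⁻ xs y∈xs) (sym (x∈⁅y⁆⇒x≡y x y∈⁅x⁆))

CliqueNumber≤⇒CliqueLength≤ : ∀ {n} {G : Graph n} {ω} → CliqueNumber≤ G ω → CliqueLength≤ G ω
CliqueNumber≤⇒CliqueLength≤ {G = G} {ω} G≤ω xs xs-clique =
  subst (_≤ ω) (∣fromList∣ unique)
    (G≤ω (fromList xs) λ x∈ y∈ → adjacent xs-clique (∈-fromList⁻ xs x∈) (∈-fromList⁻ xs y∈))
  where
  open Graph G
  unique : Unique xs
  unique = AllPairs.map (λ { x~x refl → ~-irrefl x~x }) xs-clique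
  adjacent : ∀ {xs} → AllPairs _~_ xs → ∀ {x y} → x ∈ˡ xs → y ∈ˡ xs → x ≢ y → x ~ y
  adjacent (_ ∷ _)  (here refl) (here refl) x≢y = contradiction refl x≢y
  adjacent (h ∷ _)  (here refl) (there y∈)  _   = All.lookup h y∈
  adjacent (h ∷ _)  (there x∈)  (here refl) _   = ~-sym (All.lookup h x∈)
  adjacent (_ ∷ hs) (there x∈)  (there y∈)  x≢y = adjacent hs x∈ y∈ x≢y

-- Colouring a `t`-tree by adding one vertex at a time.

-- `H` is the tree and `G` the graph to be coloured, on the same vertices. `pair` is an equality,
-- not just an upper bound, so that each non-edge of `G` inside a clique of `H` really saves a
-- colour.
record Valid {m k : ℕ} (t : ℕ) (H G : Graph m) (φ : Fin m → Subset k) : Set where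
  open Graph H using (_~_)
  field
    size   : ∀ x → ∣ φ x ∣ ≡ t
    pair   : ∀ {x y} → x ~ y → common φ x y ≡ nonEdge G x y
    triple : ∀ {x y z c} → x ~ y → y ~ z → x ~ z → c ∈ φ x → c ∈ φ y → ¬ c ∈ φ z

punchIn-view : ∀ {n} (v x : Fin (suc n)) → x ≡ v ⊎ ∃ λ y → x ≡ punchIn v y
punchIn-view v x with v Fin.≟ x
... | yes v≡x = inj₁ (sym v≡x)
... | no v≢x  = inj₂ (punchOut v≢x , sym (punchIn-punchOut v≢x))

-- For s = t this is where the clique bound enters; for s < t it is t(s + 1) ≤ t².
room-count : ∀ {t s ω d} → s ≤ t → 1 ≤ ω → suc s ≤ ω +ⁿ d → t +ⁿ t * s ≤ t * t +ⁿ (ω ∸ 1) +ⁿ d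
room-count {t} {s} {suc ω} {d} s≤t _ bound with m≤n⇒m<n∨m≡n s≤t
... | inj₁ s<t  = begin
  t +ⁿ t * s           ≡⟨ *-suc t s ⟨
  t * suc s            ≤⟨ *-monoʳ-≤ t s<t ⟩
  t * t                ≤⟨ m≤m+n (t * t) (ω +ⁿ d) ⟩
  t * t +ⁿ (ω +ⁿ d)    ≡⟨ +-assoc (t * t) ω d ⟨
  t * t +ⁿ ω +ⁿ d      ∎
  where open ≤-Reasoning
... | inj₂ refl = begin
  t +ⁿ t * t           ≡⟨ +-comm t (t * t) ⟩
  t * t +ⁿ t           ≤⟨ +-monoʳ-≤ (t * t) (s≤s⁻¹ bound) ⟩
  t * t +ⁿ (ω +ⁿ d)    ≡⟨ +-assoc (t * t) ω d ⟨
  t * t +ⁿ ω +ⁿ d      ∎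
  where open ≤-Reasoning

-- The degree of `v` is only bounded by `t`, so that the same step serves both the vertices of the
-- initial clique, with fewer than `t` earlier neighbours, and the later ones, with exactly `t`.
module AddVertex
  {n t ω : ℕ} (H G : Graph (suc n)) (v : Fin (suc n)) (1≤ω : 1 ≤ ω) (G≤ω : CliqueLength≤ G ω)
  (deg≤t : ∣ neighborhood H v ∣ ≤ t) (isClique : IsClique H (neighborhood H v))
  {φ : Fin n → Subset (t * t +ⁿ (ω ∸ 1))} (valid : Valid t (delete H v) (delete G v) φ)
  where

  open Graph H using (_~_; _~?_; ~-sym; ~-irrefl)
  open Valid valid

  neighbor? : ∀ y → Dec (v ~ punchIn v y)
  neighbor? y = v ~? punchIn v y

  K : List (Fin n)
  K = filter neighbor? (allFin n)

  ∈K⁺ : ∀ {y} → v ~ punchIn v y → y ∈ˡ K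
  ∈K⁺ {y} = ∈-filter⁺ neighbor? (∈-allFin y)

  ∈K⁻ : ∀ {y} → y ∈ˡ K → v ~ punchIn v y
  ∈K⁻ y∈ = proj₂ (∈-filter⁻ neighbor? {xs = allFin n} y∈)

  K-unique : Unique K
  K-unique = Unique.filter⁺ neighbor? (Unique.allFin⁺ n)

  K-clique : ∀ {y z} → y ∈ˡ K → z ∈ˡ K → y ≢ z → punchIn v y ~ punchIn v z
  K-clique {y} {z} y∈ z∈ y≢z =
    isClique (∈-neighborhood⁺ H (∈K⁻ y∈)) (∈-neighborhood⁺ H (∈K⁻ z∈)) (y≢z ∘ punchIn-injective v y z)

  ∣K∣≤t : length K ≤ t
  ∣K∣≤t = begin
    length K                              ≡⟨ length-map (punchIn v) K ⟨
    length (map (punchIn v) K)            ≡⟨ ∣fromList∣ (Unique.map⁺ (punchIn-injective v _ _) K-unique) ⟨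
    ∣ fromList (map (punchIn v) K) ∣      ≤⟨ p⊆q⇒∣p∣≤∣q∣ ⊆N ⟩
    ∣ neighborhood H v ∣                  ≤⟨ deg≤t ⟩
    t                                     ∎
    where
    open ≤-Reasoning
    ⊆N : fromList (map (punchIn v) K) ⊆ˢ neighborhood H v
    ⊆N x∈ with ∈-map⁻ (punchIn v) (∈-fromList⁻ (map (punchIn v) K) x∈)
    ... | y , y∈ , refl = ∈-neighborhood⁺ H (∈K⁻ y∈)

  ε : Fin n → ℕ
  ε y = nonEdge G v (punchIn v y)

  -- By `pair`, the overlaps of `φ` on `K` count the non-edges of `G` inside `K`, while `ε` counts
  -- those at `v`. Thus the non-edges forced by the clique bound become the saving that `room` asks
  -- for.
  nonEdges-in-star : pairSum (nonEdge G) (v ∷ map (punchIn v) K) ≡ pairSum (common φ) K +ⁿ sum (map ε K)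
  nonEdges-in-star = begin
    sum (map (nonEdge G v) (map (punchIn v) K)) +ⁿ pairSum (nonEdge G) (map (punchIn v) K)
      ≡⟨ cong₂ _+ⁿ_ (cong sum (sym (map-∘ K))) (pairSum-map (nonEdge G) (punchIn v) K) ⟩
    sum (map ε K) +ⁿ pairSum (nonEdge (delete G v)) K
      ≡⟨ cong (sum (map ε K) +ⁿ_) (pairSum-cong (Unique⇒AllPairs K-unique λ y∈ z∈ y≢z →
           pair (K-clique y∈ z∈ y≢z))) ⟨
    sum (map ε K) +ⁿ pairSum (common φ) K
      ≡⟨ +-comm (sum (map ε K)) _ ⟩
    pairSum (common φ) K +ⁿ sum (map ε K) ∎
    where open ≡-Reasoning

  enough-nonEdges : suc (length K) ≤ ω +ⁿ (pairSum (common φ) K +ⁿ sum (map ε K))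
  enough-nonEdges = subst₂ _≤_ (cong suc (length-map (punchIn v) K)) (cong (ω +ⁿ_) nonEdges-in-star)
    (length≤ω+nonEdges G G≤ω (v ∷ map (punchIn v) K))

  open Extension φ K K-unique ε size (λ y → nonEdge≤1 G v (punchIn v y)) ∣K∣≤t
    (λ y∈ z∈ y≢z → subst (_≤ 1) (sym (pair (K-clique y∈ z∈ y≢z))) (nonEdge≤1 G _ _))
    (λ x∈ y∈ z∈ x≢y y≢z x≢z → triple (K-clique x∈ y∈ x≢y) (K-clique y∈ z∈ y≢z) (K-clique x∈ z∈ x≢z))
    (room-count ∣K∣≤t 1≤ω enough-nonEdges)
    using (new; ∣new∣; ∣new∩φ∣; new-noTriple)

  ψ : Fin (suc n) → Subset (t * t +ⁿ (ω ∸ 1))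
  ψ = insertAt φ v new

  ψ-new : ψ v ≡ new
  ψ-new = insertAt-lookup φ v new

  ψ-old : ∀ y → ψ (punchIn v y) ≡ φ y
  ψ-old = insertAt-punchIn φ v new

  ψ-size : ∀ x → ∣ ψ x ∣ ≡ t
  ψ-size x with punchIn-view v x
  ... | inj₁ refl       = trans (cong ∣_∣ ψ-new) ∣new∣
  ... | inj₂ (y , refl) = trans (cong ∣_∣ (ψ-old y)) (size y)

  ψ-pair-new : ∀ {y} → v ~ punchIn v y → common ψ v (punchIn v y) ≡ nonEdge G v (punchIn v y)
  ψ-pair-new {y} v~y = trans (cong₂ (λ p q → ∣ p ∩ q ∣) ψ-new (ψ-old y)) (∣new∩φ∣ (∈K⁺ v~y))

  ψ-pair : ∀ {x y} → x ~ y → common ψ x y ≡ nonEdge G x y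
  ψ-pair {x} {y} x~y with punchIn-view v x | punchIn-view v y
  ... | inj₁ refl       | inj₁ refl       = contradiction x~y ~-irrefl
  ... | inj₁ refl       | inj₂ (_ , refl) = ψ-pair-new x~y
  ... | inj₂ (_ , refl) | inj₁ refl       =
    trans (cong ∣_∣ (∩-comm (ψ x) (ψ y))) (trans (ψ-pair-new (~-sym x~y)) (nonEdge-sym G y x))
  ... | inj₂ (a , refl) | inj₂ (b , refl) =
    trans (cong₂ (λ p q → ∣ p ∩ q ∣) (ψ-old a) (ψ-old b)) (pair x~y)

  ψ-triple-new : ∀ {y z c} → v ~ y → v ~ z → y ~ z → c ∈ ψ v → c ∈ ψ y → ¬ c ∈ ψ z
  ψ-triple-new {y} {z} {c} v~y v~z y~z c∈v c∈y c∈z with punchIn-view v y | punchIn-view v z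
  ... | inj₁ refl       | _               = ~-irrefl v~y
  ... | inj₂ _          | inj₁ refl       = ~-irrefl v~z
  ... | inj₂ (a , refl) | inj₂ (b , refl) =
    new-noTriple (∈K⁺ v~y) (∈K⁺ v~z) (λ { refl → ~-irrefl y~z })
      (subst (c ∈_) ψ-new c∈v) (subst (c ∈_) (ψ-old a) c∈y) (subst (c ∈_) (ψ-old b) c∈z)

  -- The condition is symmetric in the three vertices, so if `v` is among them it can be moved to
  -- the front.
  ψ-triple : ∀ {x y z c} → x ~ y → y ~ z → x ~ z → c ∈ ψ x → c ∈ ψ y → ¬ c ∈ ψ z
  ψ-triple {x} {y} {z} {c} x~y y~z x~z c∈x c∈y c∈z
    with punchIn-view v x | punchIn-view v y | punchIn-view v z
  ... | inj₁ refl | _         | _         = ψ-triple-new x~y x~z y~z c∈x c∈y c∈z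
  ... | inj₂ _    | inj₁ refl | _         = ψ-triple-new (~-sym x~y) y~z x~z c∈y c∈x c∈z
  ... | inj₂ _    | inj₂ _    | inj₁ refl = ψ-triple-new (~-sym x~z) (~-sym y~z) x~y c∈z c∈x c∈y
  ... | inj₂ (a , refl) | inj₂ (b , refl) | inj₂ (d , refl) =
    triple x~y y~z x~z
      (subst (c ∈_) (ψ-old a) c∈x) (subst (c ∈_) (ψ-old b) c∈y) (subst (c ∈_) (ψ-old d) c∈z)

  ψ-valid : Valid t H G ψ
  ψ-valid = record { size = ψ-size ; pair = ψ-pair ; triple = ψ-triple }

module _ {t ω : ℕ} (1≤ω : 1 ≤ ω) where

  -- The initial clique is also built up from the empty graph, which is why `n ≤ t` replaces `n = t`
  -- in the induction.
  valid-complete : ∀ {n} (H G : Graph n) → IsClique H ⊤ → n ≤ t → CliqueLength≤ G ω →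
                   ∃ λ (φ : Fin n → Subset (t * t +ⁿ (ω ∸ 1))) → Valid t H G φ
  valid-complete {zero}  H G _      _   _   =
    (λ ()) , record { size = λ () ; pair = λ { {()} } ; triple = λ { {()} } }
  valid-complete {suc n} H G complete n<t G≤ω =
    _ , AddVertex.ψ-valid H G Fin.zero 1≤ω G≤ω
          (≤-trans (∣p∣≤n (neighborhood H Fin.zero)) n<t)
          (λ _ _ → complete ∈⊤ ∈⊤)
          (proj₂ (valid-complete (delete H Fin.zero) (delete G Fin.zero)
            (λ _ _ x≢y → complete ∈⊤ ∈⊤ (x≢y ∘ punchIn-injective Fin.zero _ _))
            (≤-trans (n≤1+n n) n<t) (CliqueLength≤-delete {G = G} Fin.zero G≤ω)))

  -- `G` is quantified after the tree because the induction deletes `v` from both graphs.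
  valid-tree : ∀ {n} {H : Graph n} → IsTree t H → (G : Graph n) → CliqueLength≤ G ω →
               ∃ λ (φ : Fin n → Subset (t * t +ⁿ (ω ∸ 1))) → Valid t H G φ
  valid-tree {H = H} (clique isClique) G G≤ω = valid-complete H G isClique ≤-refl G≤ω
  valid-tree {H = H} (add v tree deg isClique) G G≤ω =
    _ , AddVertex.ψ-valid H G v 1≤ω G≤ω (≤-reflexive deg) isClique
          (proj₂ (valid-tree tree (delete G v) (CliqueLength≤-delete {G = G} v G≤ω)))

-- Transport from a `t`-tree to its subgraphs.

module _ {m n : ℕ} (G : Graph m) (f : Fin m → Fin n) (f-injective : ∀ {x y} → f x ≡ f y → x ≡ y) where
  open Graph G

  -- A copy of `G` on the vertex set of the tree, with all vertices outside the range of `f`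
  -- isolated, so that `Valid` can compare the two graphs.
  image : Graph n
  image = record
    { _~_      = λ x y → ∃ λ u → ∃ λ v → f u ≡ x × f v ≡ y × u ~ v
    ; _~?_     = λ x y → Fin.any? λ u → Fin.any? λ v → (f u Fin.≟ x) ×-dec (f v Fin.≟ y) ×-dec (u ~? v)
    ; ~-sym    = λ { (u , v , fu , fv , u~v) → v , u , fv , fu , ~-sym u~v }
    ; ~-irrefl = λ { (u , v , fu , fv , u~v) → ~-irrefl (subst (u ~_) (f-injective (trans fv (sym fu))) u~v) }
    }

  preimages : ∀ {ys} → All (λ y → ∃ λ u → f u ≡ y) ys → ∃ λ us → map f us ≡ ys
  preimages []                = [] , refl
  preimages ((u , refl) ∷ hs) with preimages hs
  ... | us , refl = u ∷ us , refl

  image-edge⁻ : ∀ {u v} → Graph._~_ image (f u) (f v) → u ~ v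
  image-edge⁻ (_ , _ , fu , fv , u~v) = subst₂ _~_ (f-injective fu) (f-injective fv) u~v

  -- In a clique with at least two vertices each is an end of an edge, hence has a preimage under
  -- `f`. A single vertex may lie outside the range; there `1 ≤ ω` is used.
  CliqueLength≤-image : ∀ {ω} → 1 ≤ ω → CliqueLength≤ G ω → CliqueLength≤ image ω
  CliqueLength≤-image 1≤ω G≤ω []       _ = z≤n
  CliqueLength≤-image 1≤ω G≤ω (_ ∷ []) _ = 1≤ω
  CliqueLength≤-image 1≤ω G≤ω (x ∷ y ∷ ys) (h@((u , _ , fu , _) ∷ _) ∷ hs)
    with preimages ((u , fu) ∷ All.map (λ { (_ , v , _ , fv , _) → v , fv }) h)
  ... | us , us≡ = subst (_≤ _) (trans (sym (length-map f us)) (cong length us≡))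
    (G≤ω us (AllPairs.map image-edge⁻ (AllPairs.map⁻ (subst (AllPairs (Graph._~_ image)) (sym us≡) (h ∷ hs)))))

coloring-partial-tree : ∀ {n} {G : Graph n} {t ω} → IsPartialTree t G → 1 ≤ ω → CliqueNumber≤ G ω →
                        Coloring G t (t * t +ⁿ (ω ∸ 1))
coloring-partial-tree {G = G} (_ , H , tree , f , f-inj , edge) 1≤ω G≤ω
  with valid-tree 1≤ω tree (image G f f-inj)
         (CliqueLength≤-image G f f-inj 1≤ω (CliqueNumber≤⇒CliqueLength≤ {G = G} G≤ω))
... | φ , valid = φ ∘ f , size ∘ f , λ {u} {v} u~v →
  ∣p∣≡0⇒Empty (trans (pair (edge u~v)) (nonEdge-edge (image G f f-inj) (u , v , refl , refl , u~v)))
  where open Valid valid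

-- Existence of the multichromatic number.

any-vec? : ∀ {k n} {P : Vec.Vec (Subset k) n → Set} → (∀ v → Dec (P v)) → Dec (∃ P)
any-vec? {n = zero}  P? = map′ (λ p → [] , p) (λ { ([] , p) → p }) (P? [])
any-vec? {n = suc n} P? =
  map′ (λ { (p , v , h) → p ∷ v , h }) (λ { (p ∷ v , h) → p , v , h })
       (anySubset? λ p → any-vec? λ v → P? (p ∷ v))

-- The search runs over vectors, which can be enumerated. Properness depends only on the values of a
-- colouring, so it carries over pointwise between functions and vectors.
coloring? : ∀ {n} (G : Graph n) b k → Dec (Coloring G b k)
coloring? {n} G b k = map′ to from (any-vec? λ v → proper? (Vec.lookup v))
  where
  open Graph G
  Proper : (Fin n → Subset k) → Set
  Proper φ = (∀ v → ∣ φ v ∣ ≡ b) × (∀ u v → u ~ v → Empty (φ u ∩ φ v))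
  proper? : ∀ φ → Dec (Proper φ)
  proper? φ = Fin.all? (λ v → ∣ φ v ∣ ≟ b) ×-dec
    Fin.all? λ u → Fin.all? λ v → (u ~? v) →-dec ¬? (nonempty? (φ u ∩ φ v))
  to : ∃ (λ v → Proper (Vec.lookup v)) → Coloring G b k
  to (v , size , disjoint) = Vec.lookup v , size , disjoint _ _
  from : Coloring G b k → ∃ (λ v → Proper (Vec.lookup v))
  from (φ , size , disjoint) = Vec.tabulate φ ,
    (λ v → trans (cong ∣_∣ (lookup∘tabulate φ v)) (size v)) ,
    λ u v u~v → subst₂ (λ p q → Empty (p ∩ q))
      (sym (lookup∘tabulate φ u)) (sym (lookup∘tabulate φ v)) (disjoint u~v)

-- `ChromaticRatio` admits only the least number of colours, so a colouring alone does not suffice;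
-- decidability lets the least number be found by descent from a known one.
minimum : ∀ {P : ℕ → Set} → (∀ m → Dec (P m)) → ∀ m → P m → ∃ λ k → k ≤ m × P k × (∀ j → P j → k ≤ j)
minimum {P} P? = <-rec _ λ m rec Pm → case m rec Pm
  where
  Min : ℕ → Set
  Min m = ∃ λ k → k ≤ m × P k × (∀ j → P j → k ≤ j)
  case : ∀ m → (∀ {i} → i < m → P i → Min i) → P m → Min m
  case m rec Pm with anyUpTo? P? m
  ... | no none = m , ≤-refl , Pm , λ j Pj → ≮⇒≥ λ j<m → none (j , j<m , Pj)
  ... | yes (i , i<m , Pi) with rec i<m Pi
  ...   | k , k≤i , Pk , least = k , ≤-trans k≤i (<⇒≤ i<m) , Pk , least

-- Arithmetic of the bound and conclusion.

/-bound : ∀ t ω k .{{_ : NonZero t}} → 1 ≤ ω → k ≤ t * t +ⁿ (ω ∸ 1) →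
          (+ k / t) ℚ.≤ ((+ t / 1) + ((+ ω - 1ℤ) / t))
/-bound t@(suc t-1) (suc ω) k _ k≤ = ℚ.toℚᵘ-cancel-≤ (begin
  toℚᵘ (+ k / t)                              ≃⟨ ℚ.toℚᵘ-fromℚᵘ (mkℚᵘ (+ k) t-1) ⟩
  mkℚᵘ (+ k) t-1                              ≤⟨ *≤* main ⟩
  mkℚᵘ (+ t) 0 ℚᵘ.+ mkℚᵘ (+ ω) t-1            ≃⟨ ℚᵘ.+-cong (ℚ.toℚᵘ-fromℚᵘ (mkℚᵘ (+ t) 0))
                                                            (ℚ.toℚᵘ-fromℚᵘ (mkℚᵘ (+ ω) t-1)) ⟨
  toℚᵘ (+ t / 1) ℚᵘ.+ toℚᵘ (+ ω / t)          ≃⟨ ℚ.toℚᵘ-homo-+ (+ t / 1) (+ ω / t) ⟨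
  toℚᵘ ((+ t / 1) + (+ ω / t))                ∎)
  where
  open ℚᵘ.≤-Reasoning
  -- The inequality of unnormalised fractions after cross-multiplication, with denominators `t` and
  -- `1 * t`. After the pattern match `ω` stands for the clique bound minus one.
  main : (+ k) ℤ.* (+ (1 * t)) ℤ.≤ ((+ t) ℤ.* (+ t) ℤ.+ (+ ω) ℤ.* (+ 1)) ℤ.* (+ t)
  main = subst₂ ℤ._≤_ (ℤ.pos-* k (1 * t))
    (trans (ℤ.pos-* (t * t +ⁿ ω * 1) t) (cong (ℤ._* + t) (cong₂ ℤ._+_ (ℤ.pos-* t t) (ℤ.pos-* ω 1))))
    (ℤ.+≤+ (*-mono-≤ (subst (λ w → k ≤ t * t +ⁿ w) (sym (*-identityʳ ω)) k≤) (≤-reflexive (*-identityˡ t))))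

theorem1p1 : ∀ {n} (G : Graph n) (t ω : ℕ) .{{_ : NonZero t}} →
    HasTreewidth G t → 2 ≤ ω → ω ≤ t → CliqueNumber≤ G ω →
    FractionalChromaticNumber≤ G ((+ t / 1) + ((+ ω - 1ℤ) / t))
theorem1p1 G t ω (partial-tree , _) 2≤ω _ G≤ω q r<q
  -- The multiplicity `b = t` serves every `q`: its ratio is already at most the claimed bound,
  -- hence strictly below `q`.
  with minimum (coloring? G t) _ (coloring-partial-tree {G = G} partial-tree (≤-trans (s≤s z≤n) 2≤ω) G≤ω)
... | k , k≤ , coloring , least =
  _ , ratio t k (coloring , least) , ℚ.≤-<-trans (/-bound t ω k (≤-trans (s≤s z≤n) 2≤ω) k≤) r<q
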